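{- Let $T$ be a complete first-order theory in a language $L$. If $T$ is convexly orderable, then $T$ is dp-minimal.
   Context: "Formula" means an $L$-formula without parameters; $x$ denotes a single variable, $\overline{y}, \overline{z}$ finite tuples of variables, $\mathrm{lg}(\overline{y})$ the length of $\overline{y}$, and $\varphi(M;\overline{b}) = \{a \in M : M \models \varphi(a;\overline{b})\}$. Convexly orderable: an $L$-structure $M$ is convexly orderable if there is a linear order $<$ on $M$ (not necessarily definable) such that for every $L$-formula $\varphi(x;\overline{y})$ there is $K < \omega$ such that for all $\overline{b} \in M^{\mathrm{lg}(\overline{y})}$, $\varphi(M;\overline{b})$ is a union of at most $K$ $<$-convex subsets of $M$. A theory is convexly orderable if all of its models are. Dp-minimal (standard definition): $T$ is dp-minimal if there do not exist formulas $\varphi(x;\overline{y})$, $\psi(x;\overline{z})$ with $x$ a single variable and sequences $\langle \overline{a}_i : i < \omega\rangle$, $\langle \overline{b}_j : j<\omega\rangle$ of tuples from a monster model of $T$ such that for all $i,j<\omega$ the set $\{\varphi(x;\overline{a}_i), \psi(x;\overline{b}_j)\} \cup \{\neg\varphi(x;\overline{a}_k) : k \neq i\} \cup \{\neg\psi(x;\overline{b}_l) : l \neq j\}$ is consistent. -}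

module Defs where

open import Level using (Level; suc)
open import Data.Empty.Polymorphic using (⊥)
open import Data.Fin.Base using (Fin)
open import Data.List.Base using (List)
open import Data.List.Relation.Unary.All using (All)
open import Data.Nat.Base as ℕ using (ℕ)
open import Data.Product using (Σ; Σ-syntax; ∃-syntax; _×_; _,_)
open import Data.Sum.Base using (_⊎_)
open import Data.Vec.Base using (Vec; []; _∷_; lookup)
open import Relation.Binary.Core using (Rel)
open import Relation.Binary.Structures using (IsStrictTotalOrder)
open import Relation.Binary.PropositionalEquality.Core using (_≡_; _≢_)
open import Relation.Nullary.Negation.Core using (¬_)
open import Relation.Unary using (Pred; _∈_; _≐_; ⋃)

private
  variable
    ℓ : Level
    n : ℕ

-- Constants are the function symbols of arity 0.
record Language (ℓ : Level) : Set (suc ℓ) where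
  field
    Func : ℕ → Set ℓ
    Rela : ℕ → Set ℓ

open Language public

data Term (L : Language ℓ) (n : ℕ) : Set ℓ where
  var  : Fin n → Term L n
  func : {k : ℕ} → Func L k → Vec (Term L n) k → Term L n

infix  8 _≐ᶠ_
infixr 6 _⇒_

-- Formulas whose free variables are among n de Bruijn variables; `all` binds
-- variable 0.  The connectives ⊥, ⇒, ∀ are classically complete: ∧, ∨ and ∃
-- are abbreviations, e.g. ∃ is ¬∀¬.
data Formula (L : Language ℓ) : ℕ → Set ℓ where
  _≐ᶠ_  : Term L n → Term L n → Formula L n
  rel   : {k : ℕ} → Rela L k → Vec (Term L n) k → Formula L n
  false : Formula L n
  _⇒_   : Formula L n → Formula L n → Formula L n
  all   : Formula L (ℕ.suc n) → Formula L n

neg : {L : Language ℓ} → Formula L n → Formula L n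
neg φ = φ ⇒ false

Sentence : Language ℓ → Set ℓ
Sentence L = Formula L 0

Theory : Language ℓ → Set (suc ℓ)
Theory {ℓ} L = Pred (Sentence L) ℓ

-- The symbol = is interpreted as actual equality, and structures are nonempty.
record Structure (L : Language ℓ) : Set (suc ℓ) where
  field
    Carrier  : Set ℓ
    element  : Carrier
    funcᴹ    : {k : ℕ} → Func L k → Vec Carrier k → Carrier
    relᴹ     : {k : ℕ} → Rela L k → Vec Carrier k → Set ℓ

open Structure public using (Carrier)

module _ {L : Language ℓ} (M : Structure L) where
  open Structure M using (funcᴹ; relᴹ)

  mutual
    eval : Vec (Carrier M) n → Term L n → Carrier M
    eval ρ (var i)     = lookup ρ i
    eval ρ (func f ts) = funcᴹ f (evals ρ ts)

    evals : {k : ℕ} → Vec (Carrier M) n → Vec (Term L n) k → Vec (Carrier M) k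
    evals ρ []       = []
    evals ρ (t ∷ ts) = eval ρ t ∷ evals ρ ts

  Sat : Formula L n → Vec (Carrier M) n → Set ℓ
  Sat (s ≐ᶠ t)   ρ = eval ρ s ≡ eval ρ t
  Sat (rel R ts) ρ = relᴹ R (evals ρ ts)
  Sat false      ρ = ⊥
  Sat (φ ⇒ ψ)    ρ = Sat φ ρ → Sat ψ ρ
  Sat (all φ)    ρ = (a : Carrier M) → Sat φ (a ∷ ρ)

  -- In φ(x; ȳ) the object variable x is variable 0 and ȳ is the remaining
  -- variables; this is the set φ(M; b̄).
  DefinableSet : Formula L (ℕ.suc n) → Vec (Carrier M) n → Pred (Carrier M) ℓ
  DefinableSet φ b a = Sat φ (a ∷ b)

IsModel : {L : Language ℓ} → Theory L → Structure L → Set ℓ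
IsModel {L = L} T M = (σ : Sentence L) → σ ∈ T → Sat M σ []

infix 4 _⊨_

_⊨_ : {L : Language ℓ} → Theory L → Sentence L → Set (suc ℓ)
_⊨_ {L = L} T σ = (M : Structure L) → IsModel T M → Sat M σ []

record Complete {L : Language ℓ} (T : Theory L) : Set (suc ℓ) where
  field
    satisfiable : Σ[ M ∈ Structure L ] IsModel T M
    decides     : (σ : Sentence L) → (T ⊨ σ) ⊎ (T ⊨ neg σ)

Convex : {A : Set ℓ} → Rel A ℓ → Pred A ℓ → Set ℓ
Convex _<_ C = ∀ {a b c} → a ∈ C → c ∈ C → a < b → b < c → b ∈ C

UnionOfAtMost : {A : Set ℓ} → ℕ → Rel A ℓ → Pred A ℓ → Set (suc ℓ)
UnionOfAtMost {ℓ} {A} K _<_ X =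
  ∃[ k ] k ℕ.≤ K ×
  (Σ[ C ∈ (Fin k → Pred A ℓ) ] (∀ i → Convex _<_ (C i)) × X ≐ ⋃ (Fin k) C)

record ConvexlyOrderable {L : Language ℓ} (M : Structure L) : Set (suc ℓ) where
  field
    _<_                : Rel (Carrier M) ℓ
    isStrictTotalOrder : IsStrictTotalOrder _≡_ _<_
    unionOfConvex      : ∀ {n} (φ : Formula L (ℕ.suc n)) →
      ∃[ K ] ((b : Vec (Carrier M) n) → UnionOfAtMost K _<_ (DefinableSet M φ b))

ConvexlyOrderableTheory : {L : Language ℓ} → Theory L → Set (suc ℓ)
ConvexlyOrderableTheory {L = L} T =
  (M : Structure L) → IsModel T M → ConvexlyOrderable M

-- Formulas χ(x; d̄) in the single variable x with parameters d̄ from M.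
ParamFormula : {L : Language ℓ} → Structure L → Set ℓ
ParamFormula {L = L} M = Σ[ n ∈ ℕ ] Formula L (ℕ.suc n) × Vec (Carrier M) n

Realizes : {L : Language ℓ} (M : Structure L) → Carrier M → ParamFormula M → Set ℓ
Realizes M c (_ , χ , d) = c ∈ DefinableSet M χ d

-- Consistency of a set of formulas over M, i.e. with the elementary diagram of
-- M: every finite subset is realized in M.
Consistent : {L : Language ℓ} (M : Structure L) → Pred (ParamFormula M) ℓ → Set ℓ
Consistent M p =
  (Δ : List (ParamFormula M)) → All p Δ → ∃[ c ] All (Realizes M c) Δ

-- {φ(x; āᵢ), ψ(x; b̄ⱼ)} ∪ {¬φ(x; āₖ) : k ≠ i} ∪ {¬ψ(x; b̄ₗ) : l ≠ j}
data Pattern {L : Language ℓ} (M : Structure L) {m n : ℕ}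
             (φ : Formula L (ℕ.suc m)) (ψ : Formula L (ℕ.suc n))
             (a : ℕ → Vec (Carrier M) m) (b : ℕ → Vec (Carrier M) n)
             (i j : ℕ) : Pred (ParamFormula M) ℓ where
  φ-at  : Pattern M φ ψ a b i j (m , φ , a i)
  ψ-at  : Pattern M φ ψ a b i j (n , ψ , b j)
  φ-off : ∀ {k} → k ≢ i → Pattern M φ ψ a b i j (m , neg φ , a k)
  ψ-off : ∀ {l} → l ≢ j → Pattern M φ ψ a b i j (n , neg ψ , b l)

-- The parameters range over arbitrary models of T instead of one fixed monster
-- model: every model embeds elementarily in a monster model, and finite
-- satisfiability is preserved both ways along elementary embeddings.
DpMinimal : {L : Language ℓ} → Theory L → Set (suc ℓ)
DpMinimal {L = L} T =
  ¬ (Σ[ M ∈ Structure L ] IsModel T M ×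
     (∃[ m ] ∃[ n ]
      Σ[ φ ∈ Formula L (ℕ.suc m) ] Σ[ ψ ∈ Formula L (ℕ.suc n) ]
      Σ[ a ∈ (ℕ → Vec (Carrier M) m) ] Σ[ b ∈ (ℕ → Vec (Carrier M) n) ]
      (∀ i j → Consistent M (Pattern M φ ψ a b i j))))

{-# OPTIONS --safe #-}

-- Suppose an n × n grid of points c(i,j) is such that c(i,j) ∈ φ(M; aₖ) iff
-- k = i, and c(i,j) ∈ ψ(M; bₗ) iff l = j.  Label each point by its row and a
-- convex piece of φ(M; aᵢ) containing it, and by its column and a convex piece
-- of ψ(M; bⱼ) containing it.  If c(i,j) were neither the last point with its
-- row label nor the last one with its column label, then the smaller of a later
-- point with the same row label and a later point with the same column label
-- would lie in row i and in column j, so it would be c(i,j) itself.  Hence the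
-- n² points inject into the at most n K + n K′ labels, which is absurd for
-- n > K + K′.

module Submission where

open import Defs
open import Level using (Level)
import Data.Empty.Polymorphic as Polymorphic
open import Data.Fin.Base using (Fin; toℕ; inject≤; combine; remQuot; join; splitAt)
open import Data.Fin.Properties
  using (_≟_; any?; pigeonhole; <⇒≢; toℕ-injective; inject≤-injective;
         combine-injective; combine-remQuot; splitAt-join)
open import Data.List.Base using (tabulate; _++_)
open import Data.List.Relation.Unary.All.Properties using (tabulate⁺; tabulate⁻; ++⁺; ++⁻)
open import Data.Nat.Base using (ℕ; suc; _+_; _*_; _≤_)
open import Data.Nat.Properties using (*-monoʳ-<; n<1+n; ≮⇒≥; <⇒≱)
open import Data.Product using (∃-syntax; _×_; _,_; proj₁; proj₂; map₂)
open import Data.Sum.Base using (_⊎_; inj₁; inj₂)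
open import Data.Sum.Properties using (inj₁-injective; inj₂-injective)
open import Data.Vec.Base using (Vec)
open import Function.Base using (_∘_)
open import Relation.Binary.Core using (Rel)
open import Relation.Binary.Definitions using (tri<; tri≈; tri>)
open import Relation.Binary.PropositionalEquality
  using (_≡_; refl; sym; cong; cong₂; subst; module ≡-Reasoning)
open import Relation.Binary.Structures using (IsStrictTotalOrder)
open import Relation.Nullary.Decidable using (Dec; yes; no; _×-dec_)
open import Relation.Nullary.Negation.Core using (¬_; contradiction)
open import Relation.Unary using (Pred; _∈_)

private
  variable
    ℓ : Level

join-injective : ∀ m n (s t : Fin m ⊎ Fin n) → join m n s ≡ join m n t → s ≡ t
join-injective m n s t eq = begin
  s                       ≡⟨ splitAt-join m n s ⟨
  splitAt m (join m n s)  ≡⟨ cong (splitAt m) eq ⟩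
  splitAt m (join m n t)  ≡⟨ splitAt-join m n t ⟩
  t                       ∎
  where open ≡-Reasoning

-- Counting finitely many coloured points in a linear order.

module _ {A : Set ℓ} {_≺_ : Rel A ℓ} (sto : IsStrictTotalOrder _≡_ _≺_)
         {N : ℕ} (c : Fin N → A) where

  open IsStrictTotalOrder sto using (compare; irrefl; _<?_)

  -- Convex pieces may overlap, and `piece` records just one choice for each point. A point between
  -- two others of one piece may carry a different `piece`, so `between` yields its colour alone.
  record ConvexColouring (n K : ℕ) : Set ℓ where
    field
      colour  : Fin N → Fin n
      piece   : Fin N → Fin K
      between : ∀ {x y z} → colour x ≡ colour z → piece x ≡ piece z →
                c x ≺ c y → c y ≺ c z → colour x ≡ colour y

    HasLater : Fin N → Set ℓ
    HasLater x = ∃[ y ] colour x ≡ colour y × piece x ≡ piece y × c x ≺ c y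

    -- A search through the finite set `Fin N` makes the case split in `lastInSome` constructive.
    hasLater? : ∀ x → Dec (HasLater x)
    hasLater? x = any? λ y → (colour x ≟ colour y) ×-dec (piece x ≟ piece y) ×-dec (c x <? c y)

    -- Otherwise the smaller of the two points would have the larger one as a later point with its
    -- colour and piece.
    last-unique : ∀ {x y} → ¬ HasLater x → ¬ HasLater y →
                  colour x ≡ colour y → piece x ≡ piece y → c x ≡ c y
    last-unique {x} {y} lastˣ lastʸ eqᶜ eqᵖ with compare (c x) (c y)
    ... | tri< x≺y _ _ = contradiction (y , eqᶜ , eqᵖ , x≺y) lastˣ
    ... | tri≈ _ x≡y _ = x≡y
    ... | tri> _ _ y≺x = contradiction (x , sym eqᶜ , sym eqᵖ , y≺x) lastʸ

  convexColouring : ∀ {n K} (P : Fin n → Pred A ℓ) → (∀ i → UnionOfAtMost K _≺_ (P i)) →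
                    (h : Fin N → Fin n) → (∀ x → c x ∈ P (h x)) →
                    (∀ x i → c x ∈ P i → i ≡ h x) → ConvexColouring n K
  convexColouring {n} {K} P union h c∈P unique = record
    { colour  = h
    ; piece   = λ x → pieceOf (c∈P x)
    ; between = λ {x} {y} {z} eqʰ eqᵖ x≺y y≺z →
        unique y (h x) (pieceOf-convex eqʰ (c∈P x) (c∈P z) eqᵖ x≺y y≺z)
    }
    where
    pieceOf : ∀ {i a} → a ∈ P i → Fin K
    pieceOf {i} a∈P with union i
    -- The number of pieces varies with `i`; `inject≤` moves every index into the common `Fin K`.
    ... | _ , k≤K , _ , _ , P⊆⋃ , _ = inject≤ (proj₁ (P⊆⋃ a∈P)) k≤K

    -- The two indices are kept apart because the outer points come with memberships in `P (h x)`
    -- and `P (h z)`, where `h x` and `h z` are only propositionally equal.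
    pieceOf-convex : ∀ {i i′ a b d} → i ≡ i′ → (a∈P : a ∈ P i) (d∈P : d ∈ P i′) →
                     pieceOf a∈P ≡ pieceOf d∈P → a ≺ b → b ≺ d → b ∈ P i
    pieceOf-convex {i} {d = d} refl a∈P d∈P eq a≺b b≺d with union i
    ... | _ , k≤K , C , convex , P⊆⋃ , ⋃⊆P =
      let p , a∈C = P⊆⋃ a∈P
          q , d∈C = P⊆⋃ d∈P
          q≡p     = sym (inject≤-injective k≤K k≤K p q eq)
      in ⋃⊆P (p , convex p a∈C (subst (λ r → d ∈ C r) q≡p d∈C) a≺b b≺d)

  module _ {n K₁ K₂ : ℕ} (R₁ : ConvexColouring n K₁) (R₂ : ConvexColouring n K₂) where

    private
      module R₁ = ConvexColouring R₁
      module R₂ = ConvexColouring R₂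

    module _ (c-injective : ∀ {x y} → c x ≡ c y → x ≡ y)
             (colours-injective : ∀ {x y} → R₁.colour x ≡ R₁.colour y →
                                  R₂.colour x ≡ R₂.colour y → x ≡ y) where

      ¬both-later : ∀ {x} → R₁.HasLater x → ¬ R₂.HasLater x
      ¬both-later (y , eqᶜ₁ , eqᵖ₁ , x≺y) (z , eqᶜ₂ , eqᵖ₂ , x≺z) with compare (c y) (c z)
      ... | tri< y≺z _ _ =
        irrefl (cong c (colours-injective eqᶜ₁ (R₂.between eqᶜ₂ eqᵖ₂ x≺y y≺z))) x≺y
      -- The two later points coincide, so this point shares both colours with `x` and convexity
      -- does not enter.
      ... | tri≈ _ y≡z _ with refl ← c-injective y≡z =
        irrefl (cong c (colours-injective eqᶜ₁ eqᶜ₂)) x≺y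
      ... | tri> _ _ z≺y =
        irrefl (cong c (colours-injective (R₁.between eqᶜ₁ eqᵖ₁ x≺z z≺y) eqᶜ₂)) x≺z

      LastInSome : Fin N → Set ℓ
      LastInSome x = (¬ R₁.HasLater x) ⊎ (¬ R₂.HasLater x)

      lastInSome : ∀ x → LastInSome x
      lastInSome x with R₁.hasLater? x
      ... | yes later₁ = inj₂ (¬both-later later₁)
      ... | no last₁   = inj₁ last₁

      -- The side of `join` tells in which colouring `x` is last, so the two kinds of label stay
      -- disjoint although their colours share `Fin n`.
      label : ∀ x → LastInSome x → Fin (n * (K₁ + K₂))
      label x (inj₁ _) = combine (R₁.colour x) (join K₁ K₂ (inj₁ (R₁.piece x)))
      label x (inj₂ _) = combine (R₂.colour x) (join K₁ K₂ (inj₂ (R₂.piece x)))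

      split-label : ∀ (i j : Fin n) (s t : Fin K₁ ⊎ Fin K₂) →
                    combine i (join K₁ K₂ s) ≡ combine j (join K₁ K₂ t) → i ≡ j × s ≡ t
      split-label i j s t eq =
        map₂ (join-injective K₁ K₂ s t)
             (combine-injective i (join K₁ K₂ s) j (join K₁ K₂ t) eq)

      -- Equal labels come from the same side of `join`, where `last-unique` applies. The witnesses
      -- `s` and `t` are arguments so that the sides can be matched on.
      label-injective : ∀ x y (s : LastInSome x) (t : LastInSome y) →
                        label x s ≡ label y t → x ≡ y
      label-injective x y (inj₁ lastˣ) (inj₁ lastʸ) eq with split-label _ _ (inj₁ _) (inj₁ _) eq
      ... | eqᶜ , eqᵖ = c-injective (R₁.last-unique lastˣ lastʸ eqᶜ (inj₁-injective eqᵖ))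
      label-injective x y (inj₁ _) (inj₂ _) eq with split-label _ _ (inj₁ _) (inj₂ _) eq
      ... | _ , ()
      label-injective x y (inj₂ _) (inj₁ _) eq with split-label _ _ (inj₂ _) (inj₁ _) eq
      ... | _ , ()
      label-injective x y (inj₂ lastˣ) (inj₂ lastʸ) eq with split-label _ _ (inj₂ _) (inj₂ _) eq
      ... | eqᶜ , eqᵖ = c-injective (R₂.last-unique lastˣ lastʸ eqᶜ (inj₂-injective eqᵖ))

      points-bounded : N ≤ n * (K₁ + K₂)
      points-bounded = ≮⇒≥ λ labels<N →
        let x , y , x<y , eq = pigeonhole labels<N (λ x → label x (lastInSome x))
        in <⇒≢ x<y (label-injective x y (lastInSome x) (lastInSome y) eq)

-- From consistent patterns to finite grids in the model.

module _ {L : Language ℓ} (M : Structure L) where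

  consistent-tabulate : ∀ {p m n} → Consistent M p →
    (f : Fin m → ParamFormula M) (g : Fin n → ParamFormula M) →
    (∀ i → f i ∈ p) → (∀ j → g j ∈ p) →
    ∃[ c ] (∀ i → Realizes M c (f i)) × (∀ j → Realizes M c (g j))
  consistent-tabulate con f g f∈p g∈p =
    let c , holds       = con (tabulate f ++ tabulate g) (++⁺ (tabulate⁺ f∈p) (tabulate⁺ g∈p))
        holdsᶠ , holdsᵍ = ++⁻ (tabulate f) holds
    in c , tabulate⁻ holdsᶠ , tabulate⁻ holdsᵍ

  -- The decision is an argument, not computed inside, so that later proofs can match on it.
  literal : ∀ {m n} → Formula L (suc m) → (ℕ → Vec (Carrier M) m) →
            (i k : Fin n) → Dec (k ≡ i) → ParamFormula M
  literal φ a i k (yes _) = _ , φ , a (toℕ k)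
  literal φ a i k (no _)  = _ , neg φ , a (toℕ k)

  literals-decide : ∀ {m n} (φ : Formula L (suc m)) a {i : Fin n} {c} →
    (∀ k → Realizes M c (literal φ a i k (k ≟ i))) →
    c ∈ DefinableSet M φ (a (toℕ i)) × (∀ k → c ∈ DefinableSet M φ (a (toℕ k)) → k ≡ i)
  literals-decide φ a {i} {c} holds =
    positive (i ≟ i) (holds i) , λ k → negative k (k ≟ i) (holds k)
    where
    positive : (d : Dec (i ≡ i)) → Realizes M c (literal φ a i i d) →
               c ∈ DefinableSet M φ (a (toℕ i))
    positive (yes _)  c∈φ = c∈φ
    positive (no i≢i) _   = contradiction refl i≢i

    negative : ∀ k (d : Dec (k ≡ i)) → Realizes M c (literal φ a i k d) →
               c ∈ DefinableSet M φ (a (toℕ k)) → k ≡ i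
    negative k (yes k≡i) _   _   = k≡i
    negative k (no _)    c∉φ c∈φ = Polymorphic.⊥-elim (c∉φ c∈φ)

  module _ {m n} {φ : Formula L (suc m)} {ψ : Formula L (suc n)}
           {a : ℕ → Vec (Carrier M) m} {b : ℕ → Vec (Carrier M) n} where

    literalφ∈Pattern : ∀ {r} {i : Fin r} {j} k d →
                       literal φ a i k d ∈ Pattern M φ ψ a b (toℕ i) j
    literalφ∈Pattern k (yes refl) = φ-at
    literalφ∈Pattern k (no k≢i)   = φ-off (k≢i ∘ toℕ-injective)

    literalψ∈Pattern : ∀ {r} {j : Fin r} {i} l d →
                       literal ψ b j l d ∈ Pattern M φ ψ a b i (toℕ j)
    literalψ∈Pattern l (yes refl) = ψ-at
    literalψ∈Pattern l (no l≢j)   = ψ-off (l≢j ∘ toℕ-injective)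

    module _ (con : ∀ i j → Consistent M (Pattern M φ ψ a b i j)) where

      -- Only the parameters of index below `r` are involved, so finitely many formulas of the
      -- pattern suffice, and consistency realizes them in `M` itself.
      gridPoint : ∀ {r} (i j : Fin r) → ∃[ c ]
        (c ∈ DefinableSet M φ (a (toℕ i)) × (∀ k → c ∈ DefinableSet M φ (a (toℕ k)) → k ≡ i)) ×
        (c ∈ DefinableSet M ψ (b (toℕ j)) × (∀ l → c ∈ DefinableSet M ψ (b (toℕ l)) → l ≡ j))
      gridPoint i j =
        let c , holdsφ , holdsψ = consistent-tabulate (con (toℕ i) (toℕ j))
              (λ k → literal φ a i k (k ≟ i)) (λ l → literal ψ b j l (l ≟ j))
              (λ k → literalφ∈Pattern k (k ≟ i)) (λ l → literalψ∈Pattern l (l ≟ j))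
        in c , literals-decide φ a holdsφ , literals-decide ψ b holdsψ

      ¬convexlyOrderable : ¬ ConvexlyOrderable M
      ¬convexlyOrderable order = <⇒≱ (*-monoʳ-< r (n<1+n (K + K′)))
        (points-bounded isStrictTotalOrder c rows columns c-injective row,column-injective)
        where
        open ConvexlyOrderable order

        K K′ r : ℕ
        K  = proj₁ (unionOfConvex φ)
        K′ = proj₁ (unionOfConvex ψ)
        -- With this side length the `r * (K + K′)` labels are strictly fewer than the `r * r`
        -- cells.
        r  = suc (K + K′)

        -- The grid is indexed through `remQuot` because the pigeonhole count needs a single `Fin`.
        row column : Fin (r * r) → Fin r
        row    = proj₁ ∘ remQuot {r} r
        column = proj₂ ∘ remQuot {r} r

        point : ∀ x → _
        point x = gridPoint (row x) (column x)

        c : Fin (r * r) → Carrier M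
        c = proj₁ ∘ point

        c∈φ : ∀ x → c x ∈ DefinableSet M φ (a (toℕ (row x)))
        c∈φ = proj₁ ∘ proj₁ ∘ proj₂ ∘ point

        row-unique : ∀ x k → c x ∈ DefinableSet M φ (a (toℕ k)) → k ≡ row x
        row-unique = proj₂ ∘ proj₁ ∘ proj₂ ∘ point

        c∈ψ : ∀ x → c x ∈ DefinableSet M ψ (b (toℕ (column x)))
        c∈ψ = proj₁ ∘ proj₂ ∘ proj₂ ∘ point

        column-unique : ∀ x l → c x ∈ DefinableSet M ψ (b (toℕ l)) → l ≡ column x
        column-unique = proj₂ ∘ proj₂ ∘ proj₂ ∘ point

        row,column-injective : ∀ {x y} → row x ≡ row y → column x ≡ column y → x ≡ y
        row,column-injective {x} {y} eqʳ eqᶜ = begin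
          x                          ≡⟨ combine-remQuot {r} r x ⟨
          combine (row x) (column x) ≡⟨ cong₂ combine eqʳ eqᶜ ⟩
          combine (row y) (column y) ≡⟨ combine-remQuot {r} r y ⟩
          y                          ∎
          where open ≡-Reasoning

        -- The common value satisfies the instance of `φ` for the row of `x`, while uniqueness at
        -- `y` allows only the row of `y`; likewise for `ψ` and columns.
        c-injective : ∀ {x y} → c x ≡ c y → x ≡ y
        c-injective {x} {y} eq = row,column-injective
          (row-unique y (row x) (subst (_∈ DefinableSet M φ (a (toℕ (row x)))) eq (c∈φ x)))
          (column-unique y (column x) (subst (_∈ DefinableSet M ψ (b (toℕ (column x)))) eq (c∈ψ x)))

        rows : ConvexColouring isStrictTotalOrder c r K
        rows = convexColouring isStrictTotalOrder c (λ i → DefinableSet M φ (a (toℕ i)))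
          (λ i → proj₂ (unionOfConvex φ) (a (toℕ i))) row c∈φ row-unique

        columns : ConvexColouring isStrictTotalOrder c r K′
        columns = convexColouring isStrictTotalOrder c (λ j → DefinableSet M ψ (b (toℕ j)))
          (λ j → proj₂ (unionOfConvex ψ) (b (toℕ j))) column c∈ψ column-unique

corollary2p9 : {ℓ : Level} {L : Language ℓ} (T : Theory L) →
    Complete T → ConvexlyOrderableTheory T → DpMinimal T
corollary2p9 T _ orderable (M , M⊨T , _ , _ , _ , _ , _ , _ , con) =
  ¬convexlyOrderable M con (orderable M M⊨T)
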